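{- Let $G=(V,A)$ be an Eulerian digraph and let $s\in V$. For each recurrent configuration $c$ of the chip-firing game on $G$ with sink $s$, let $\mathrm{sum}_{G,s}(c)=\deg^+_G(s)+\sum_{v\neq s}c(v)$. Let $c_1,\dots,c_p$ be the recurrent configurations with respect to sink $s$. Then the sequence $(\mathrm{sum}_{G,s}(c_i))_{1\le i\le p}$ is independent of the choice of $s$, up to a permutation of its entries (i.e. the multiset $\{\mathrm{sum}_{G,s}(c): c \text{ recurrent w.r.t. } s\}$ does not depend on $s$).
   Context: All digraphs are finite multi-digraphs without loops. For vertices $u,w$, $\deg_G(u,w)$ is the number of arcs from $u$ to $w$; $\deg^+_G,\deg^-_G$ are out- and in-degree. $G$ is Eulerian if it is connected and $\deg^-_G(v)=\deg^+_G(v)$ for all $v$ (hence strongly connected). Chip-firing game on $G$ with sink $s$: a configuration is a map $c:V\setminus\{s\}\to\mathbb{N}$. A vertex $v\neq s$ is firable if $c(v)\ge \deg^+_G(v)$; firing $v$ decreases $c(v)$ by $\deg^+_G(v)$ and increases $c(w)$ by $\deg_G(v,w)$ for each $w\notin\{v,s\}$ (chips sent to $s$ vanish); $s$ never fires. From any configuration $c$, repeated firing terminates in a unique stable configuration (no firable vertex) $c^\circ$. $c+d$ is the pointwise sum. A stable configuration $c$ is recurrent if for every configuration $d$ there is a configuration $d'$ with $(d+d')^\circ=c$. -}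

module Defs where

open import Data.Nat using (ℕ; zero; suc; _+_; _∸_; _≤_; _<_)
open import Data.Fin using (Fin)
open import Data.Vec using (Vec; lookup; tabulate; sum)
open import Data.Product using (Σ; _×_; _,_)
open import Data.Sum using (_⊎_)
open import Data.List using (List)
open import Data.List.Membership.Propositional using (_∈_)
open import Data.List.Relation.Unary.Unique.Propositional using (Unique)
open import Relation.Binary.PropositionalEquality using (_≡_)
open import Relation.Nullary using (¬_; yes; no)
open import Data.Fin using (_≟_)

-- A finite multi-digraph on vertex set Fin n:
-- arcs u w = number of arcs from u to w.
record Digraph (n : ℕ) : Set where
  field
    arcs   : Fin n → Fin n → ℕ
    loopless : ∀ v → arcs v v ≡ 0
open Digraph public

module _ {n : ℕ} (G : Digraph n) where

  outdeg : Fin n → ℕ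
  outdeg v = sum (tabulate (λ w → arcs G v w))

  indeg : Fin n → ℕ
  indeg v = sum (tabulate (λ u → arcs G u v))

  Adjacent : Fin n → Fin n → Set
  Adjacent u w = (0 < arcs G u w) ⊎ (0 < arcs G w u)

  data Linked : Fin n → Fin n → Set where
    here : ∀ {u} → Linked u u
    step : ∀ {u v w} → Adjacent u v → Linked v w → Linked u w

  Connected : Set
  Connected = ∀ u w → Linked u w

  Eulerian : Set
  Eulerian = Connected × (∀ v → indeg v ≡ outdeg v)

  -- A configuration w.r.t. sink s: a vector of chip counts whose s-entry is 0
  -- (the s-entry is a dummy coordinate standing for "no value at s").
  Config : Fin n → Vec ℕ n → Set
  Config s c = lookup c s ≡ 0

  fire : Fin n → Fin n → Vec ℕ n → Vec ℕ n
  fire s v c = tabulate f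
    where
    f : Fin n → ℕ
    f w with w ≟ s | w ≟ v
    ... | yes _ | _     = lookup c w
    ... | no _  | yes _ = lookup c w ∸ outdeg v
    ... | no _  | no _  = lookup c w + arcs G v w

  Firable : Fin n → Vec ℕ n → Fin n → Set
  Firable s c v = ¬ (v ≡ s) × outdeg v ≤ lookup c v

  Stable : Fin n → Vec ℕ n → Set
  Stable s c = ∀ v → ¬ Firable s c v

  data Fires (s : Fin n) : Vec ℕ n → Vec ℕ n → Set where
    done : ∀ {c} → Fires s c c
    fire-step : ∀ {c c' v} → Firable s c v → Fires s (fire s v c) c' → Fires s c c'

  Stabilizes : Fin n → Vec ℕ n → Vec ℕ n → Set
  Stabilizes s c c' = Fires s c c' × Stable s c'

  _⊕_ : Vec ℕ n → Vec ℕ n → Vec ℕ n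
  c ⊕ d = tabulate (λ v → lookup c v + lookup d v)

  Recurrent : Fin n → Vec ℕ n → Set
  Recurrent s c =
    Config s c × Stable s c ×
    (∀ d → Config s d → Σ (Vec ℕ n) (λ d' → Config s d' × Stabilizes s (d ⊕ d') c))

  -- sum_{G,s}(c) = outdeg s + Σ_{v ≠ s} c(v)   (the s-entry of c is 0)
  sumGs : Fin n → Vec ℕ n → ℕ
  sumGs s c = outdeg s + sum c

  EnumeratesRecurrent : Fin n → List (Vec ℕ n) → Set
  EnumeratesRecurrent s L = Unique L × (∀ c → (c ∈ L → Recurrent s c) × (Recurrent s c → c ∈ L))

{-# OPTIONS --safe #-}
module Submission where

open import Defs
import Data.Nat as ℕ
open import Data.Nat using (ℕ; zero; suc; _+_; _*_; _∸_; _≤_; _<_; z≤n; s≤s; _<?_; _≤?_)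
open import Data.Nat.Properties hiding (_≟_)
open import Data.Nat.Tactic.RingSolver using (solve-∀)
open import Data.Bool using (Bool; true; false; if_then_else_; _∧_; not)
import Data.Bool.Properties as Bool
open import Data.Fin using (Fin; zero; suc; _≟_)
open import Data.Fin.Properties using (any?)
open import Data.Vec using (Vec; lookup; tabulate; sum)
open import Data.Vec.Properties using (lookup∘tabulate; tabulate∘lookup; tabulate-cong)
open import Data.List using (List; []; _∷_; _++_; map; filter; length; allFin)
open import Data.List.Properties using (filter-accept; filter-reject)
open import Data.List.Extrema ≤-totalOrder using (argmax; f[xs]≤f[argmax])
open import Data.List.Membership.Propositional using (_∈_)
open import Data.List.Membership.Propositional.Properties using (∈-∃++; ∈-filter⁺; ∈-filter⁻; ∈-++⁺ˡ; ∈-++⁺ʳ; ∈-++⁻; ∈-allFin)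
open import Data.List.Relation.Unary.Any using (here; there)
import Data.List.Relation.Unary.All as All
open import Data.List.Relation.Unary.AllPairs using (_∷_)
open import Data.List.Relation.Unary.Unique.Propositional using (Unique)
open import Data.List.Relation.Unary.Unique.Propositional.Properties using (filter⁺)
open import Data.List.Relation.Binary.Permutation.Propositional using (_↭_; ↭-refl; ↭-sym; ↭-trans; prep)
open import Data.List.Relation.Binary.Permutation.Propositional.Properties using (shift; ↭-length; filter-↭)
open import Data.Product using (∃; ∃₂; _×_; _,_; proj₁; proj₂)
open import Data.Sum using (inj₁; inj₂)
open import Data.Unit using (⊤; tt)
open import Function using (_∘_)
open import Relation.Nullary using (¬_; Dec; yes; no; does; contradiction)
open import Relation.Nullary.Decidable using (dec-true; dec-false; ¬?; _×-dec_)
open import Relation.Binary.PropositionalEquality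
import Algebra.Properties.Semiring.Sum +-*-semiring as Sum

-- Call a configuration C of chips on all of V allowed if every nonempty A ⊆ V contains a vertex v
-- with C(v) at least the number of arcs from A to v.  With a sink s, only sets A ∌ s are required.
-- Firing preserves this, and a stable configuration is recurrent exactly when it is allowed off s;
-- a maximum principle shows that each class modulo the Laplacian has at most one such configuration.
--
-- Fix k.  If c is recurrent for s and sum(c) ≤ k, put the k − Σc ≥ deg⁺(s) remaining chips on s.
-- The result is allowed on all of V.  Fire vertices other than t until they are all stable: the
-- outcome is still allowed, so off t it is recurrent for t, and A = V shows that t holds at least
-- deg⁺(t) chips.  Up to the Laplacian nothing changed, so this is an injection from the c with
-- sum_s(c) ≤ k into the c′ with sum_t(c′) ≤ k.  By symmetry these numbers agree for every k, and
-- they determine the multiset of sums.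

-- Sums over Fin n

-- Recursion on both indices, instead of a test with `_≟_`, lets the successor case of `∑-δ` hold by
-- computation.
δ : ∀ {n} → Fin n → Fin n → ℕ
δ zero    zero    = 1
δ zero    (suc j) = 0
δ (suc i) zero    = 0
δ (suc i) (suc j) = δ i j

δ-refl : ∀ {n} (i : Fin n) → δ i i ≡ 1
δ-refl zero    = refl
δ-refl (suc i) = δ-refl i

δ≤δ-refl : ∀ {n} (i j : Fin n) → δ i j ≤ δ i i
δ≤δ-refl zero    zero    = ≤-refl
δ≤δ-refl zero    (suc j) = z≤n
δ≤δ-refl (suc i) zero    = z≤n
δ≤δ-refl (suc i) (suc j) = δ≤δ-refl i j

δ-≢ : ∀ {n} {i j : Fin n} → i ≢ j → δ i j ≡ 0
δ-≢ {i = zero}  {zero}  i≢j = contradiction refl i≢j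
δ-≢ {i = zero}  {suc j} i≢j = refl
δ-≢ {i = suc i} {zero}  i≢j = refl
δ-≢ {i = suc i} {suc j} i≢j = δ-≢ (i≢j ∘ cong suc)

opaque
  -- Opaque, so that goals keep `∑` folded; outside this block `sum-tabulate` is the bridge to the
  -- sums in `outdeg` and `indeg`.
  ∑ : ∀ {n} → (Fin n → ℕ) → ℕ
  ∑ f = sum (tabulate f)

  sum-tabulate : ∀ {n} (f : Fin n → ℕ) → sum (tabulate f) ≡ ∑ f
  sum-tabulate f = refl

  ∑≡sum : ∀ {n} (f : Fin n → ℕ) → ∑ f ≡ Sum.sum f
  ∑≡sum {zero}  f = refl
  ∑≡sum {suc n} f = cong (f zero +_) (∑≡sum (f ∘ suc))

  ∑-cong : ∀ {n} {f g : Fin n → ℕ} → (∀ i → f i ≡ g i) → ∑ f ≡ ∑ g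
  ∑-cong f≗g = cong sum (tabulate-cong f≗g)

  ∑-+ : ∀ {n} (f g : Fin n → ℕ) → ∑ (λ i → f i + g i) ≡ ∑ f + ∑ g
  ∑-+ f g = begin
    ∑ (λ i → f i + g i)       ≡⟨ ∑≡sum (λ i → f i + g i) ⟩
    Sum.sum (λ i → f i + g i) ≡⟨ Sum.∑-distrib-+ f g ⟩
    Sum.sum f + Sum.sum g     ≡⟨ cong₂ _+_ (∑≡sum f) (∑≡sum g) ⟨
    ∑ f + ∑ g                 ∎
    where open ≡-Reasoning

  ∑-*ˡ : ∀ {n} k (f : Fin n → ℕ) → ∑ (λ i → k * f i) ≡ k * ∑ f
  ∑-*ˡ k f = begin
    ∑ (λ i → k * f i)       ≡⟨ ∑≡sum (λ i → k * f i) ⟩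
    Sum.sum (λ i → k * f i) ≡⟨ Sum.*-distribˡ-sum k f ⟨
    k * Sum.sum f           ≡⟨ cong (k *_) (∑≡sum f) ⟨
    k * ∑ f                 ∎
    where open ≡-Reasoning

  ∑-swap : ∀ {m n} (f : Fin m → Fin n → ℕ) →
    ∑ (λ i → ∑ (f i)) ≡ ∑ (λ j → ∑ (λ i → f i j))
  ∑-swap f = begin
    ∑ (λ i → ∑ (f i))                       ≡⟨ ∑-cong (λ i → ∑≡sum (f i)) ⟩
    ∑ (λ i → Sum.sum (f i))                 ≡⟨ ∑≡sum (λ i → Sum.sum (f i)) ⟩
    Sum.sum (λ i → Sum.sum (f i))           ≡⟨ Sum.∑-comm f ⟩
    Sum.sum (λ j → Sum.sum (λ i → f i j))   ≡⟨ ∑≡sum (λ j → Sum.sum (λ i → f i j)) ⟨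
    ∑ (λ j → Sum.sum (λ i → f i j))         ≡⟨ ∑-cong (λ j → ∑≡sum (λ i → f i j)) ⟨
    ∑ (λ j → ∑ (λ i → f i j))               ∎
    where open ≡-Reasoning

  ∑-mono : ∀ {n} {f g : Fin n → ℕ} → (∀ i → f i ≤ g i) → ∑ f ≤ ∑ g
  ∑-mono {zero}  f≤g = z≤n
  ∑-mono {suc n} f≤g = +-mono-≤ (f≤g zero) (∑-mono (f≤g ∘ suc))

  ∑-zero : ∀ {n} {f : Fin n → ℕ} → (∀ i → f i ≡ 0) → ∑ f ≡ 0
  ∑-zero {zero}  f≡0 = refl
  ∑-zero {suc n} f≡0 = cong₂ _+_ (f≡0 zero) (∑-zero (f≡0 ∘ suc))

  term≤∑ : ∀ {n} (f : Fin n → ℕ) i → f i ≤ ∑ f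
  term≤∑ f zero    = m≤m+n _ _
  term≤∑ f (suc i) = ≤-trans (term≤∑ (f ∘ suc) i) (m≤n+m _ _)

  ∑>0⇒∃>0 : ∀ {n} (f : Fin n → ℕ) → 0 < ∑ f → ∃ λ i → 0 < f i
  ∑>0⇒∃>0 {suc n} f 0<∑ with f zero in f₀
  ... | suc _ = zero , subst (0 <_) (sym f₀) (s≤s z≤n)
  ... | zero  = let i , 0<fi = ∑>0⇒∃>0 (f ∘ suc) 0<∑ in suc i , 0<fi

  -- A strict inequality in any one term would make the totals differ.
  ∑-mono-tight : ∀ {n} {f g : Fin n → ℕ} → (∀ i → f i ≤ g i) → ∑ g ≤ ∑ f → ∀ i → g i ≤ f i
  ∑-mono-tight {suc n} {f} {g} f≤g ∑g≤∑f zero    =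
    +-cancelʳ-≤ (∑ (g ∘ suc)) _ _ (≤-trans ∑g≤∑f (+-monoʳ-≤ (f zero) (∑-mono (f≤g ∘ suc))))
  ∑-mono-tight {suc n} {f} {g} f≤g ∑g≤∑f (suc i) =
    ∑-mono-tight (f≤g ∘ suc)
      (+-cancelˡ-≤ (g zero) _ _ (≤-trans ∑g≤∑f (+-monoˡ-≤ _ (f≤g zero)))) i

  ∑-δ : ∀ {n} (i : Fin n) (f : Fin n → ℕ) → ∑ (λ j → δ i j * f j) ≡ f i
  ∑-δ zero    f = trans (cong (f zero + 0 +_) (∑-zero {f = λ j → δ zero (suc j) * f (suc j)} (λ _ → refl)))
    (trans (+-identityʳ _) (+-identityʳ _))
  ∑-δ (suc i) f = ∑-δ i (f ∘ suc)

∑-δ-one : ∀ {n} (i : Fin n) → ∑ (δ i) ≡ 1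
∑-δ-one i = trans (∑-cong (λ j → sym (*-identityʳ (δ i j)))) (∑-δ i (λ _ → 1))

sum-lookup : ∀ {n} (c : Vec ℕ n) → sum c ≡ ∑ (lookup c)
sum-lookup c = trans (cong sum (sym (tabulate∘lookup c))) (sum-tabulate (lookup c))

lookup-ext : ∀ {n} {c d : Vec ℕ n} → (∀ i → lookup c i ≡ lookup d i) → c ≡ d
lookup-ext {c = c} {d} eq =
  trans (sym (tabulate∘lookup c)) (trans (tabulate-cong eq) (tabulate∘lookup d))

-- Counting

-- Pigeonhole: each head of `xs` has its partner deleted from `ys`. A relation is used because
-- partners are only known to exist.
matching-length-≤ : ∀ {A : Set} (_∼_ : A → A → Set) →
  (∀ {x x′ y} → x ∼ y → x′ ∼ y → x ≡ x′) →
  ∀ xs ys → Unique xs → (∀ {x} → x ∈ xs → ∃ λ y → y ∈ ys × x ∼ y) →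
  length xs ≤ length ys
matching-length-≤ _∼_ inj []       ys _ _ = z≤n
matching-length-≤ _∼_ inj (x ∷ xs) ys (x∉xs ∷ uniq) match
  with y , y∈ys , x∼y ← match (here refl)
  with ys₁ , ys₂ , refl ← ∈-∃++ y∈ys = begin
    suc (length xs)                ≤⟨ s≤s (matching-length-≤ _∼_ inj xs (ys₁ ++ ys₂) uniq match′) ⟩
    suc (length (ys₁ ++ ys₂))      ≡⟨ ↭-length (shift y ys₁ ys₂) ⟨
    length (ys₁ ++ y ∷ ys₂)        ∎
  where
  open ≤-Reasoning
  match′ : ∀ {x′} → x′ ∈ xs → ∃ λ y′ → y′ ∈ ys₁ ++ ys₂ × x′ ∼ y′
  match′ x′∈xs with match (there x′∈xs)
  ... | y′ , y′∈ , x′∼y′ with ∈-++⁻ ys₁ y′∈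
  ...   | inj₁ ∈₁           = y′ , ∈-++⁺ˡ ∈₁ , x′∼y′
  ...   | inj₂ (there ∈₂)   = y′ , ∈-++⁺ʳ ys₁ ∈₂ , x′∼y′
  -- The deleted entry cannot also be the partner of `x′`, which would then equal the head `x`,
  -- against uniqueness.
  ...   | inj₂ (here refl)  = contradiction (inj x∼y x′∼y′) (All.lookup x∉xs x′∈xs)

#below : ℕ → List ℕ → ℕ
#below k xs = length (filter (_<? k) xs)

#below-↭ : ∀ k {xs ys} → xs ↭ ys → #below k xs ≡ #below k ys
#below-↭ k p = ↭-length (filter-↭ (_<? k) p)

#below-∷-< : ∀ {k x} xs → x < k → #below k (x ∷ xs) ≡ suc (#below k xs)
#below-∷-< {k} xs x<k = cong length (filter-accept (_<? k) x<k)

#below-∷-≮ : ∀ {k x} xs → ¬ x < k → #below k (x ∷ xs) ≡ #below k xs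
#below-∷-≮ {k} xs x≮k = cong length (filter-reject (_<? k) x≮k)

#below-∷-cancel : ∀ k x {xs ys} → #below k (x ∷ xs) ≡ #below k (x ∷ ys) → #below k xs ≡ #below k ys
#below-∷-cancel k x {xs} {ys} eq with x <? k
... | yes x<k = suc-injective (trans (sym (#below-∷-< xs x<k)) (trans eq (#below-∷-< ys x<k)))
... | no  x≮k = trans (sym (#below-∷-≮ xs x≮k)) (trans eq (#below-∷-≮ ys x≮k))

#below-mono : ∀ k xs → #below k xs ≤ #below (suc k) xs
#below-mono k []       = z≤n
#below-mono k (x ∷ xs) with x <? k | x <? suc k
... | yes x<k | yes x<1+k = subst₂ _≤_ (sym (#below-∷-< xs x<k)) (sym (#below-∷-< xs x<1+k)) (s≤s (#below-mono k xs))
... | yes x<k | no  x≮1+k = contradiction (m<n⇒m<1+n x<k) x≮1+k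
... | no  x≮k | yes x<1+k = subst₂ _≤_ (sym (#below-∷-≮ xs x≮k)) (sym (#below-∷-< xs x<1+k)) (m≤n⇒m≤1+n (#below-mono k xs))
... | no  x≮k | no  x≮1+k = subst₂ _≤_ (sym (#below-∷-≮ xs x≮k)) (sym (#below-∷-≮ xs x≮1+k)) (#below-mono k xs)

#below-jump : ∀ x xs → #below x (x ∷ xs) < #below (suc x) (x ∷ xs)
#below-jump x xs =
  subst₂ _<_ (sym (#below-∷-≮ xs (n≮n x))) (sym (#below-∷-< xs (n<1+n x))) (s≤s (#below-mono x xs))

#below-jump⇒∈ : ∀ x ys → #below x ys < #below (suc x) ys → x ∈ ys
#below-jump⇒∈ x (y ∷ ys) jump with y <? x | y <? suc x
... | yes y<x | yes y<1+x =
  there (#below-jump⇒∈ x ys (≤-pred (subst₂ _<_ (#below-∷-< ys y<x) (#below-∷-< ys y<1+x) jump)))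
... | yes y<x | no  y≮1+x = contradiction (m<n⇒m<1+n y<x) y≮1+x
... | no  y≮x | yes y<1+x = here (≤-antisym (≮⇒≥ y≮x) (≤-pred y<1+x))
... | no  y≮x | no  y≮1+x =
  there (#below-jump⇒∈ x ys (subst₂ _<_ (#below-∷-≮ ys y≮x) (#below-∷-≮ ys y≮1+x) jump))

-- The count jumps between `x` and `suc x` only if `x` occurs in the list, so the head of `xs` is
-- found in `ys`. Removing it from both sides keeps the counts equal.
#below-≡⇒↭ : ∀ xs ys → (∀ k → #below k xs ≡ #below k ys) → xs ↭ ys
#below-≡⇒↭ []       []       eq = ↭-refl
#below-≡⇒↭ []       (y ∷ ys) eq =
  contradiction (trans (eq (suc y)) (#below-∷-< ys (n<1+n y))) 0≢1+n
#below-≡⇒↭ (x ∷ xs) ys       eq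
  with ys₁ , ys₂ , refl ← ∈-∃++ (#below-jump⇒∈ x ys (subst₂ _<_ (eq x) (eq (suc x)) (#below-jump x xs))) =
  ↭-trans
    (prep x (#below-≡⇒↭ xs (ys₁ ++ ys₂) λ k →
      #below-∷-cancel k x (trans (eq k) (#below-↭ k (shift x ys₁ ys₂)))))
    (↭-sym (shift x ys₁ ys₂))

#below-map : ∀ {A : Set} (f : A → ℕ) k xs → #below k (map f xs) ≡ length (filter (λ x → f x <? k) xs)
#below-map f k []       = refl
#below-map f k (x ∷ xs) with f x <? k
... | yes fx<k = begin
  #below k (f x ∷ map f xs)                       ≡⟨ #below-∷-< (map f xs) fx<k ⟩
  suc (#below k (map f xs))                       ≡⟨ cong suc (#below-map f k xs) ⟩
  suc (length (filter (λ x → f x <? k) xs))       ≡⟨ cong length (filter-accept (λ x → f x <? k) fx<k) ⟨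
  length (filter (λ x → f x <? k) (x ∷ xs))       ∎
  where open ≡-Reasoning
... | no  fx≮k = begin
  #below k (f x ∷ map f xs)                       ≡⟨ #below-∷-≮ (map f xs) fx≮k ⟩
  #below k (map f xs)                             ≡⟨ #below-map f k xs ⟩
  length (filter (λ x → f x <? k) xs)             ≡⟨ cong length (filter-reject (λ x → f x <? k) fx≮k) ⟨
  length (filter (λ x → f x <? k) (x ∷ xs))       ∎
  where open ≡-Reasoning

-- Firing and allowed configurations

does⇒ : ∀ {P : Set} (P? : Dec P) → does P? ≡ true → P
does⇒ (yes p) _ = p

𝟙 : Bool → ℕ
𝟙 true  = 1
𝟙 false = 0

𝟙≤1 : ∀ b → 𝟙 b ≤ 1
𝟙≤1 true  = ≤-refl
𝟙≤1 false = z≤n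

maximal : ∀ {n} → Fin n → (x : Fin n → ℕ) → ∃ λ m → ∀ w → x w ≤ x m
maximal s x = argmax x s (allFin _) , λ w → All.lookup (f[xs]≤f[argmax] {f = x} s (allFin _)) (∈-allFin w)

restrict : ∀ {n} → Fin n → (Fin n → ℕ) → Vec ℕ n
restrict s f = tabulate (λ v → if does (v ≟ s) then 0 else f v)

lookup-restrict-sink : ∀ {n} (s : Fin n) f → lookup (restrict s f) s ≡ 0
lookup-restrict-sink s f =
  trans (lookup∘tabulate _ s) (cong (if_then 0 else f s) (dec-true (s ≟ s) refl))

lookup-restrict : ∀ {n} (s : Fin n) f {v} → v ≢ s → lookup (restrict s f) v ≡ f v
lookup-restrict s f {v} v≢s =
  trans (lookup∘tabulate _ v) (cong (if_then 0 else f v) (dec-false (v ≟ s) v≢s))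

∑-restrict : ∀ {n} (s : Fin n) f → ∑ f ≡ sum (restrict s f) + f s
∑-restrict s f = begin
  ∑ f                                                   ≡⟨ ∑-cong split ⟩
  ∑ (λ v → lookup (restrict s f) v + δ s v * f v)       ≡⟨ ∑-+ _ _ ⟩
  ∑ (lookup (restrict s f)) + ∑ (λ v → δ s v * f v)     ≡⟨ cong₂ _+_ (sym (sum-lookup (restrict s f))) (∑-δ s f) ⟩
  sum (restrict s f) + f s                              ∎
  where
  open ≡-Reasoning
  split : ∀ v → f v ≡ lookup (restrict s f) v + δ s v * f v
  split v with v ≟ s
  ... | yes refl = sym (trans (cong₂ (λ a d → a + d * f s) (lookup-restrict-sink s f) (δ-refl s)) (*-identityˡ (f s)))
  ... | no  v≢s  = sym (trans (cong₂ (λ a d → a + d * f v) (lookup-restrict s f v≢s) (δ-≢ (v≢s ∘ sym))) (+-identityʳ (f v)))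

module _ {n : ℕ} (G : Digraph n) where

  -- For a firing vector this is what `v` receives; for an indicator `𝟙 ∘ A` it is the number of
  -- arcs from A to `v`.
  inflow : (Fin n → ℕ) → Fin n → ℕ
  inflow x v = ∑ (λ u → x u * arcs G u v)

  inflow-mono : ∀ {x y} → (∀ u → x u ≤ y u) → ∀ v → inflow x v ≤ inflow y v
  inflow-mono x≤y v = ∑-mono (λ u → *-monoˡ-≤ (arcs G u v) (x≤y u))

  inflow-cong : ∀ {x y} → (∀ u → x u ≡ y u) → ∀ v → inflow x v ≡ inflow y v
  inflow-cong x≗y v = ∑-cong (λ u → cong (_* arcs G u v) (x≗y u))

  inflow-+ : ∀ x y v → inflow (λ u → x u + y u) v ≡ inflow x v + inflow y v
  inflow-+ x y v = trans (∑-cong (λ u → *-distribʳ-+ (arcs G u v) (x u) (y u))) (∑-+ _ _)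

  inflow-*ˡ : ∀ k x v → inflow (λ u → k * x u) v ≡ k * inflow x v
  inflow-*ˡ k x v = trans (∑-cong (λ u → *-assoc k (x u) (arcs G u v))) (∑-*ˡ k _)

  inflow-const : ∀ k v → inflow (λ _ → k) v ≡ k * indeg G v
  inflow-const k v = trans (∑-*ˡ k _) (cong (k *_) (sym (sum-tabulate _)))

  inflow-δ : ∀ u v → inflow (δ u) v ≡ arcs G u v
  inflow-δ u v = ∑-δ u (λ u → arcs G u v)

  -- Firing every u exactly x u times takes the number of chips on v from a to b.
  record Moves (x : Fin n → ℕ) (v : Fin n) (a b : ℕ) : Set where
    constructor moves
    field equation : a + inflow x v ≡ b + x v * outdeg G v
  open Moves public

  Moves-cong : ∀ {x y v a b} → (∀ u → x u ≡ y u) → Moves x v a b → Moves y v a b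
  Moves-cong {x} {y} {v} {a} {b} x≗y (moves mx) = moves (begin
    a + inflow y v         ≡⟨ cong (a +_) (inflow-cong x≗y v) ⟨
    a + inflow x v         ≡⟨ mx ⟩
    b + x v * outdeg G v   ≡⟨ cong (λ k → b + k * outdeg G v) (x≗y v) ⟩
    b + y v * outdeg G v   ∎)
    where open ≡-Reasoning

  Moves-zero : ∀ {v a} → Moves (λ _ → 0) v a a
  Moves-zero {v} {a} = moves (cong (a +_) (inflow-const 0 v))

  Moves-trans : ∀ {x y v a b c} → Moves x v a b → Moves y v b c → Moves (λ u → x u + y u) v a c
  Moves-trans {x} {y} {v} {a} {b} {c} (moves mx) (moves my) = moves (begin
    a + inflow (λ u → x u + y u) v                ≡⟨ cong (a +_) (inflow-+ x y v) ⟩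
    a + (inflow x v + inflow y v)                 ≡⟨ +-assoc a _ _ ⟨
    a + inflow x v + inflow y v                   ≡⟨ cong (_+ inflow y v) mx ⟩
    b + x v * outdeg G v + inflow y v             ≡⟨ swapʳ b _ _ ⟩
    b + inflow y v + x v * outdeg G v             ≡⟨ cong (_+ x v * outdeg G v) my ⟩
    c + y v * outdeg G v + x v * outdeg G v       ≡⟨ collect c (x v) (y v) (outdeg G v) ⟩
    c + (x v + y v) * outdeg G v                  ∎)
    where
    open ≡-Reasoning
    swapʳ : ∀ a b c → a + b + c ≡ a + c + b
    swapʳ = solve-∀
    collect : ∀ a x y d → a + y * d + x * d ≡ a + (x + y) * d
    collect = solve-∀

  -- Firing vectors take values in ℕ, so this cancellation of an initial part replaces subtraction
  -- of vectors.
  Moves-cancel : ∀ {x y v a b c} → Moves x v a b → Moves (λ u → x u + y u) v a c → Moves y v b c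
  Moves-cancel {x} {y} {v} {a} {b} {c} (moves mx) (moves mxy) = moves (+-cancelʳ-≡ (x v * outdeg G v) _ _ (begin
    b + inflow y v + x v * outdeg G v             ≡⟨ swapʳ b _ _ ⟩
    b + x v * outdeg G v + inflow y v             ≡⟨ cong (_+ inflow y v) mx ⟨
    a + inflow x v + inflow y v                   ≡⟨ +-assoc a _ _ ⟩
    a + (inflow x v + inflow y v)                 ≡⟨ cong (a +_) (inflow-+ x y v) ⟨
    a + inflow (λ u → x u + y u) v                ≡⟨ mxy ⟩
    c + (x v + y v) * outdeg G v                  ≡⟨ expand c (x v) (y v) (outdeg G v) ⟩
    c + y v * outdeg G v + x v * outdeg G v       ∎))
    where
    open ≡-Reasoning
    swapʳ : ∀ a b c → a + b + c ≡ a + c + b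
    swapʳ = solve-∀
    expand : ∀ a x y d → a + (x + y) * d ≡ a + y * d + x * d
    expand = solve-∀

  ∑-inflow : ∀ x → ∑ (inflow x) ≡ ∑ (λ u → x u * outdeg G u)
  ∑-inflow x = begin
    ∑ (inflow x)                          ≡⟨ ∑-swap (λ v u → x u * arcs G u v) ⟩
    ∑ (λ u → ∑ (λ v → x u * arcs G u v))  ≡⟨ ∑-cong (λ u → ∑-*ˡ (x u) (arcs G u)) ⟩
    ∑ (λ u → x u * ∑ (arcs G u))          ≡⟨ ∑-cong (λ u → cong (x u *_) (sum-tabulate (arcs G u))) ⟨
    ∑ (λ u → x u * outdeg G u)            ∎
    where open ≡-Reasoning

  Moves-∑ : ∀ {x C C′} → (∀ v → Moves x v (C v) (C′ v)) → ∑ C ≡ ∑ C′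
  Moves-∑ {x} {C} {C′} mv = +-cancelʳ-≡ (∑ (inflow x)) _ _ (begin
    ∑ C + ∑ (inflow x)                    ≡⟨ ∑-+ C (inflow x) ⟨
    ∑ (λ v → C v + inflow x v)            ≡⟨ ∑-cong (λ v → equation (mv v)) ⟩
    ∑ (λ v → C′ v + x v * outdeg G v)     ≡⟨ ∑-+ C′ _ ⟩
    ∑ C′ + ∑ (λ u → x u * outdeg G u)     ≡⟨ cong (∑ C′ +_) (∑-inflow x) ⟨
    ∑ C′ + ∑ (inflow x)                   ∎)
    where open ≡-Reasoning

  -- For Q = (_≢ s) this is Dhar's condition that C has no forbidden subconfiguration.
  Allowed : (Fin n → Set) → (Fin n → ℕ) → Set
  Allowed Q C = ∀ (A : Fin n → Bool) → ∃ (λ v → A v ≡ true) → (∀ v → A v ≡ true → Q v) →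
    ∃ λ v → A v ≡ true × inflow (𝟙 ∘ A) v ≤ C v

  -- Apply the condition on `C` to A without `w`. Putting `w` back adds `arcs G w v` to the arcs
  -- into the vertex `v` found, which is what `v` gains when `w` fires.
  allowed-fire : ∀ {Q C C′} w → Allowed Q C →
    (∀ v → Q v → v ≢ w → C v + arcs G w v ≤ C′ v) → Allowed Q C′
  allowed-fire {Q} {C} {C′} w allowed C≤C′ A (a , a∈A) A⊆Q
    with any? (λ v → (A v ∧ not (does (v ≟ w))) Bool.≟ true)
  ... | yes (v₀ , v₀∈A′) = go (allowed A′ (v₀ , v₀∈A′) λ v v∈A′ → A⊆Q v (proj₁ (A′⇒ v v∈A′)))
    where
    A′ : Fin n → Bool
    A′ v = A v ∧ not (does (v ≟ w))
    A′⇒ : ∀ v → A′ v ≡ true → A v ≡ true × v ≢ w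
    A′⇒ v v∈A′ with A v | v ≟ w
    ... | true | no v≢w = refl , v≢w
    A≤ : ∀ u → 𝟙 (A u) ≤ 𝟙 (A′ u) + δ w u
    A≤ u with u ≟ w
    ... | yes refl = ≤-trans (𝟙≤1 (A u)) (≤-trans (≤-reflexive (sym (δ-refl u))) (m≤n+m _ _))
    ... | no  _    = ≤-trans (≤-reflexive (cong 𝟙 (sym (Bool.∧-identityʳ (A u))))) (m≤m+n _ _)
    go : (∃ λ v → A′ v ≡ true × inflow (𝟙 ∘ A′) v ≤ C v) →
      ∃ λ v → A v ≡ true × inflow (𝟙 ∘ A) v ≤ C′ v
    go (v , v∈A′ , low) = v , proj₁ (A′⇒ v v∈A′) , (begin
      inflow (𝟙 ∘ A) v                        ≤⟨ inflow-mono A≤ v ⟩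
      inflow (λ u → 𝟙 (A′ u) + δ w u) v       ≡⟨ inflow-+ (𝟙 ∘ A′) (δ w) v ⟩
      inflow (𝟙 ∘ A′) v + inflow (δ w) v      ≡⟨ cong (inflow (𝟙 ∘ A′) v +_) (inflow-δ w v) ⟩
      inflow (𝟙 ∘ A′) v + arcs G w v          ≤⟨ +-monoˡ-≤ _ low ⟩
      C v + arcs G w v                        ≤⟨ C≤C′ v (A⊆Q v (proj₁ (A′⇒ v v∈A′))) (proj₂ (A′⇒ v v∈A′)) ⟩
      C′ v                                    ∎)
      where open ≤-Reasoning
  -- Here A is the singleton of `w`, and without loops no arc leads from A to its only vertex.
  ... | no A′-empty = a , a∈A , ≤-trans (≤-reflexive inflow≡0) z≤n
    where
    only-w : ∀ u → A u ≡ true → u ≡ w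
    only-w u u∈A with u ≟ w
    ... | yes u≡w = u≡w
    ... | no  u≢w = contradiction
      (u , cong₂ _∧_ u∈A (cong not (dec-false (u ≟ w) u≢w))) A′-empty
    term≡0 : ∀ u → 𝟙 (A u) * arcs G u a ≡ 0
    term≡0 u with A u in u∈?A
    ... | false = refl
    ... | true  rewrite only-w u u∈?A | only-w a a∈A = cong (_+ 0) (loopless G w)
    inflow≡0 : inflow (𝟙 ∘ A) a ≡ 0
    inflow≡0 = ∑-zero term≡0

  lookup-fire-sink : ∀ s v c → lookup (fire G s v c) s ≡ lookup c s
  -- `unfold` is abstracted together with the tests so that its type reduces along the branches of
  -- `fire`.
  lookup-fire-sink s v c with s ≟ s | s ≟ v | unfold
    where
    unfold : lookup (fire G s v c) s ≡ _
    unfold = lookup∘tabulate _ s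
  ... | yes _   | _ | eq = eq
  ... | no  s≢s | _ | _  = contradiction refl s≢s

  -- The balance holds only off `s`, because chips sent to the sink vanish.
  fire-Moves : ∀ {s v} c → outdeg G v ≤ lookup c v → ∀ w → w ≢ s →
    Moves (δ v) w (lookup c w) (lookup (fire G s v c) w)
  fire-Moves {s} {v} c deg≤c w w≢s = moves (trans (cong (lookup c w +_) (inflow-δ v w)) moved)
    where
    unfold : lookup (fire G s v c) w ≡ _
    unfold = lookup∘tabulate _ w
    moved : lookup c w + arcs G v w ≡ lookup (fire G s v c) w + δ v w * outdeg G w
    moved with w ≟ s | w ≟ v | unfold
    ... | yes w≡s | _        | _  = contradiction w≡s w≢s
    ... | no  _   | yes refl | eq = begin
      lookup c w + arcs G w w                              ≡⟨ cong (lookup c w +_) (loopless G w) ⟩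
      lookup c w + 0                                       ≡⟨ +-identityʳ _ ⟩
      lookup c w                                           ≡⟨ m∸n+n≡m deg≤c ⟨
      lookup c w ∸ outdeg G w + outdeg G w                 ≡⟨ cong₂ _+_ eq (*-identityˡ (outdeg G w)) ⟨
      lookup (fire G s w c) w + 1 * outdeg G w             ≡⟨ cong (λ d → lookup (fire G s w c) w + d * outdeg G w) (δ-refl w) ⟨
      lookup (fire G s w c) w + δ w w * outdeg G w         ∎
      where open ≡-Reasoning
    ... | no  _   | no  w≢v  | eq = begin
      lookup c w + arcs G v w                              ≡⟨ eq ⟨
      lookup (fire G s v c) w                              ≡⟨ +-identityʳ _ ⟨
      lookup (fire G s v c) w + 0 * outdeg G w             ≡⟨ cong (λ d → lookup (fire G s v c) w + d * outdeg G w) (δ-≢ (w≢v ∘ sym)) ⟨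
      lookup (fire G s v c) w + δ v w * outdeg G w         ∎
      where open ≡-Reasoning

  Moves-δ-off : ∀ {u v a b} → v ≢ u → Moves (δ u) v a b → a + arcs G u v ≡ b
  Moves-δ-off {u} {v} {a} {b} v≢u (moves mv) = begin
    a + arcs G u v               ≡⟨ cong (a +_) (inflow-δ u v) ⟨
    a + inflow (δ u) v           ≡⟨ mv ⟩
    b + δ u v * outdeg G v       ≡⟨ cong (λ d → b + d * outdeg G v) (δ-≢ (v≢u ∘ sym)) ⟩
    b + 0                        ≡⟨ +-identityʳ _ ⟩
    b                            ∎
    where open ≡-Reasoning

  fires-allowed : ∀ {s c c′} → Fires G s c c′ → Allowed (_≢ s) (lookup c) → Allowed (_≢ s) (lookup c′)
  fires-allowed done allowed = allowed
  fires-allowed {s} {c} (fire-step {v = v} (v≢s , deg≤c) fires) allowed =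
    fires-allowed fires (allowed-fire v allowed λ w w≢s w≢v →
      ≤-reflexive (Moves-δ-off w≢v (fire-Moves c deg≤c w w≢s)))

  -- Supports without leaving arcs, and superharmonic functions

  Crossing : (Fin n → ℕ) → Set
  Crossing y = ∃₂ λ u v → 0 < y u × y v ≡ 0 × 0 < arcs G u v

  crossing? : ∀ y → Dec (Crossing y)
  crossing? y = any? λ u → any? λ v → (0 <? y u) ×-dec (y v ℕ.≟ 0) ×-dec (0 <? arcs G u v)

sg : ℕ → ℕ
sg zero    = 0
sg (suc _) = 1

module _ {n : ℕ} (G : Digraph n) (eulerian : Eulerian G) where

  private
    balanced = proj₂ eulerian

  -- As many arcs enter the support of y as leave it, so if none leaves it then none enters it.
  no-crossing⇒no-entering : ∀ y → ¬ Crossing G y → ∀ u v → sg (y v) * arcs G u v ≤ sg (y u) * arcs G u v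
  no-crossing⇒no-entering y closed u = ∑-mono-tight (leaving≤ u) (∑-mono-tight (λ u → ∑-mono (leaving≤ u)) total u)
    where
    leaving≤ : ∀ u v → sg (y u) * arcs G u v ≤ sg (y v) * arcs G u v
    leaving≤ u v with y u in yu | y v in yv | arcs G u v in a
    ... | zero  | _     | _     = z≤n
    ... | suc _ | suc _ | _     = ≤-refl
    ... | suc _ | zero  | zero  = z≤n
    ... | suc _ | zero  | suc _ = contradiction
      (u , v , subst (0 <_) (sym yu) (s≤s z≤n) , yv , subst (0 <_) (sym a) (s≤s z≤n)) closed
    total : ∑ (λ u → ∑ λ v → sg (y v) * arcs G u v) ≤ ∑ (λ u → ∑ λ v → sg (y u) * arcs G u v)
    total = ≤-reflexive (begin
      ∑ (λ u → ∑ λ v → sg (y v) * arcs G u v)    ≡⟨ ∑-swap (λ u v → sg (y v) * arcs G u v) ⟩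
      ∑ (λ v → ∑ λ u → sg (y v) * arcs G u v)    ≡⟨ ∑-cong (λ v → ∑-*ˡ (sg (y v)) (λ u → arcs G u v)) ⟩
      ∑ (λ v → sg (y v) * ∑ (λ u → arcs G u v))  ≡⟨ ∑-cong (λ v → cong (sg (y v) *_) (in≡out v)) ⟩
      ∑ (λ v → sg (y v) * ∑ (arcs G v))          ≡⟨ ∑-cong (λ v → ∑-*ˡ (sg (y v)) (arcs G v)) ⟨
      ∑ (λ u → ∑ λ v → sg (y u) * arcs G u v)    ∎)
      where
      open ≡-Reasoning
      in≡out : ∀ v → ∑ (λ u → arcs G u v) ≡ ∑ (arcs G v)
      in≡out v = trans (sym (sum-tabulate (λ u → arcs G u v))) (trans (balanced v) (sum-tabulate (arcs G v)))

  -- A support that no arc leaves is entered by none either, so it is closed under adjacency in both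
  -- directions, and connectivity makes it everything.
  no-crossing⇒positive : ∀ y {s} → 0 < y s → ¬ Crossing G y → ∀ v → 0 < y v
  no-crossing⇒positive y {s} 0<ys closed v = spread (proj₁ eulerian s v) 0<ys
    where
    across : ∀ {u v} → Adjacent G u v → 0 < y u → 0 < y v
    across {u} {v} (inj₁ out) 0<yu = n≢0⇒n>0 λ yv≡0 → closed (u , v , 0<yu , yv≡0 , out)
    across {u} {v} (inj₂ into) 0<yu = n≢0⇒n>0 absurd
      where
      absurd : y v ≢ 0
      absurd yv≡0 with y u | y v | no-crossing⇒no-entering y closed v u
      absurd refl | suc _ | zero | le = contradiction (≤-trans into (≤-trans (m≤m+n _ 0) le)) λ ()
      absurd refl | zero | zero | le = contradiction 0<yu λ ()
    spread : ∀ {u v} → Linked G u v → 0 < y u → 0 < y v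
    spread here         0<yu = 0<yu
    spread (step adj l) 0<yu = spread l (across adj 0<yu)

  private
    module Growth (s : Fin n) (D : ℕ) where

      -- Superharmonic with margin `D`, but off `s` only on the support. So `δ s` qualifies
      -- vacuously, and the support can grow one vertex at a time.
      Admissible : (Fin n → ℕ) → Set
      Admissible y = (∀ v → y v ≤ y s) × (∀ v → v ≢ s → 0 < y v → outdeg G v * y v + D ≤ inflow G y v)

      -- Multiplying y by B leaves room for the value 1 at a new vertex v that has an arc from the support of y.
      extend : ∀ y → 0 < y s → Admissible y → Crossing G y →
        ∃ λ y′ → 0 < y′ s × Admissible y′ × ∑ (λ v → 1 ∸ y′ v) < ∑ (λ v → 1 ∸ y v)
      extend y 0<ys (y≤ys , super) (u , v , 0<yu , yv≡0 , 0<a) =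
        y′ , ≤-trans 0<ys (y≤y′ s) , (y′≤y′s , super′) , fewer
        where
        -- The new value 1 at `v` requires an inflow of `outdeg G v + D`, which one arc from the
        -- support now supplies. The `suc` keeps `B` positive, so that `y ≤ y′`.
        B = suc (outdeg G v + D)
        y′ : Fin n → ℕ
        y′ w = B * y w + δ v w
        y≤y′ : ∀ w → y w ≤ y′ w
        y≤y′ w = ≤-trans (m≤m+n (y w) _) (m≤m+n (B * y w) (δ v w))
        y′-v : y′ v ≡ 1
        y′-v = trans (cong₂ _+_ (trans (cong (B *_) yv≡0) (*-zeroʳ B)) (δ-refl v)) refl
        y′-off : ∀ {w} → w ≢ v → y′ w ≡ B * y w
        y′-off {w} w≢v = trans (cong (B * y w +_) (δ-≢ (w≢v ∘ sym))) (+-identityʳ _)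
        y′≤y′s : ∀ w → y′ w ≤ y′ s
        y′≤y′s w with w ≟ v
        ... | yes refl = ≤-trans (≤-reflexive y′-v) (≤-trans 0<ys (y≤y′ s))
        ... | no  w≢v  = ≤-trans (≤-reflexive (y′-off w≢v)) (≤-trans (*-monoʳ-≤ B (y≤ys w)) (m≤m+n _ _))
        super′ : ∀ w → w ≢ s → 0 < y′ w → outdeg G w * y′ w + D ≤ inflow G y′ w
        super′ w w≢s 0<y′w with w ≟ v
        ... | yes refl = begin
          outdeg G v * y′ v + D           ≡⟨ cong (λ k → outdeg G v * k + D) y′-v ⟩
          outdeg G v * 1 + D              ≡⟨ cong (_+ D) (*-identityʳ _) ⟩
          outdeg G v + D                  ≤⟨ n≤1+n _ ⟩
          B                               ≡⟨ trans (*-identityʳ _) (*-identityʳ B) ⟨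
          B * 1 * 1                       ≤⟨ *-mono-≤ (*-monoʳ-≤ B 0<yu) 0<a ⟩
          B * y u * arcs G u v            ≤⟨ *-monoˡ-≤ (arcs G u v) (m≤m+n (B * y u) (δ v u)) ⟩
          y′ u * arcs G u v               ≤⟨ term≤∑ (λ u → y′ u * arcs G u v) u ⟩
          inflow G y′ v                   ∎
          where open ≤-Reasoning
        ... | no  w≢v = begin
          outdeg G w * y′ w + D           ≡⟨ cong (λ k → outdeg G w * k + D) (y′-off w≢v) ⟩
          outdeg G w * (B * y w) + D      ≤⟨ +-monoʳ-≤ (outdeg G w * (B * y w)) (m≤m+n D _) ⟩
          outdeg G w * (B * y w) + B * D  ≡⟨ factor (outdeg G w) B (y w) D ⟩
          B * (outdeg G w * y w + D)      ≤⟨ *-monoʳ-≤ B (super w w≢s 0<yw) ⟩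
          B * inflow G y w                ≡⟨ inflow-*ˡ G B y w ⟨
          inflow G (λ u → B * y u) w      ≤⟨ inflow-mono G (λ u → m≤m+n (B * y u) (δ v u)) w ⟩
          inflow G y′ w                   ∎
          where
          open ≤-Reasoning
          factor : ∀ o b y d → o * (b * y) + b * d ≡ b * (o * y + d)
          factor = solve-∀
          0<yw : 0 < y w
          0<yw = n≢0⇒n>0 λ yw≡0 → contradiction
            (subst (0 <_) (trans (y′-off w≢v) (trans (cong (B *_) yw≡0) (*-zeroʳ B))) 0<y′w) λ ()
        zeros : ∀ w → 1 ∸ y′ w + δ v w ≤ 1 ∸ y w
        zeros w with w ≟ v
        ... | yes refl = ≤-reflexive (trans (cong₂ (λ a b → 1 ∸ a + b) y′-v (δ-refl v)) (cong (1 ∸_) (sym yv≡0)))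
        ... | no  w≢v  = ≤-trans (≤-reflexive (trans (cong (1 ∸ y′ w +_) (δ-≢ (w≢v ∘ sym))) (+-identityʳ _)))
                                 (∸-monoʳ-≤ 1 (y≤y′ w))
        fewer : ∑ (λ w → 1 ∸ y′ w) < ∑ (λ w → 1 ∸ y w)
        fewer = begin
          suc (∑ (λ w → 1 ∸ y′ w))          ≡⟨ +-comm (∑ (λ w → 1 ∸ y′ w)) 1 ⟨
          ∑ (λ w → 1 ∸ y′ w) + 1            ≡⟨ cong (∑ (λ w → 1 ∸ y′ w) +_) (∑-δ-one v) ⟨
          ∑ (λ w → 1 ∸ y′ w) + ∑ (δ v)      ≡⟨ ∑-+ _ (δ v) ⟨
          ∑ (λ w → 1 ∸ y′ w + δ v w)        ≤⟨ ∑-mono zeros ⟩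
          ∑ (λ w → 1 ∸ y w)                 ∎
          where open ≤-Reasoning

      -- The sum counts the zeros of `y`, and every extension lowers it, so `k` serves as fuel.
      -- Extensions are possible until no arc leaves the support, which by then is everything.
      saturate : ∀ k y → ∑ (λ v → 1 ∸ y v) ≤ k → 0 < y s → Admissible y →
        ∃ λ y → (∀ v → 0 < y v) × Admissible y
      saturate k y zeros≤k 0<ys adm with crossing? G y
      ... | no  closed = y , no-crossing⇒positive y 0<ys closed , adm
      ... | yes cross with extend y 0<ys adm cross | k
      ...   | y′ , 0<y′s , adm′ , fewer | zero   = contradiction (≤-trans fewer zeros≤k) λ ()
      ...   | y′ , 0<y′s , adm′ , fewer | suc k′ = saturate k′ y′ (≤-pred (≤-trans fewer zeros≤k)) 0<y′s adm′

  opaque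
    -- Used twice: on `G` as a firing vector that raises every vertex off `s` by at least `D`, and
    -- on the reversed digraph as a weight that grows under firing.
    superharmonic : ∀ s D → ∃ λ y → (∀ v → y v ≤ y s) × (∀ v → v ≢ s → outdeg G v * y v + D ≤ inflow G y v)
    superharmonic s D
      with y , pos , y≤ys , super ← Growth.saturate s D _ (δ s) ≤-refl (≤-reflexive (sym (δ-refl s))) (δ≤δ-refl s , λ v v≢s 0<δ →
        contradiction (subst (0 <_) (δ-≢ (v≢s ∘ sym)) 0<δ) λ ())
      = y , y≤ys , λ v v≢s → super v v≢s (pos v)

  -- The maximum principle and legal firing sequences

  inflow-const-outdeg : ∀ k v → inflow G (λ _ → k) v ≡ k * outdeg G v
  inflow-const-outdeg k v = trans (inflow-const G k v) (cong (k *_) (balanced v))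

  -- By balance, firing every vertex `N` times changes nothing, so `N ∸ x` undoes `x`.
  Moves-reverse : ∀ {x N v a b} → (∀ u → x u ≤ N) → Moves G x v a b → Moves G (λ u → N ∸ x u) v b a
  Moves-reverse {x} {N} {v} {a} x≤N mv = Moves-cancel G mv
    (Moves-cong G (λ u → sym (m+[n∸m]≡n (x≤N u))) (moves (cong (a +_) (inflow-const-outdeg N v))))

  -- A vertex where x is maximal and where the allowed configuration C′ is large on the set of all
  -- maxima of x has enough chips in C to fire.
  opaque
    unsaturated⇒firable : ∀ {s x} {C C′ : Fin n → ℕ} → (∀ v → v ≢ s → Moves G x v (C v) (C′ v)) →
      Allowed G (_≢ s) C′ → ∀ {w} → x s < x w → ∃ λ v → v ≢ s × 0 < x v × outdeg G v ≤ C v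
    unsaturated⇒firable {s} {x} {C} {C′} mv allowed {w} xs<xw
      with m , x≤xm ← maximal s x
      with v , v∈A , low ← allowed (λ u → does (x u ℕ.≟ x m)) (m , dec-true (x m ℕ.≟ x m) refl)
        (λ u u∈A u≡s → <⇒≢ (<-≤-trans xs<xw (x≤xm w))
          (trans (cong x (sym u≡s)) (does⇒ (x u ℕ.≟ x m) u∈A)))
      = v , v≢s , ≤-trans (s≤s z≤n) (subst (x s <_) (sym xv≡xm) xs<xm) , +-cancelˡ-≤ (inflow G x v) _ _ (begin
        inflow G x v + outdeg G v                      ≡⟨ cong (inflow G x v +_) (trans (inflow-const-outdeg 1 v) (*-identityˡ _)) ⟨
        inflow G x v + inflow G (λ _ → 1) v            ≡⟨ inflow-+ G x (λ _ → 1) v ⟨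
        inflow G (λ u → x u + 1) v                     ≤⟨ inflow-mono G below v ⟩
        inflow G (λ u → x m + 𝟙 (A u)) v               ≡⟨ inflow-+ G (λ _ → x m) (𝟙 ∘ A) v ⟩
        inflow G (λ _ → x m) v + inflow G (𝟙 ∘ A) v    ≤⟨ +-monoʳ-≤ _ low ⟩
        inflow G (λ _ → x m) v + C′ v                  ≡⟨ cong (_+ C′ v) (inflow-const-outdeg (x m) v) ⟩
        x m * outdeg G v + C′ v                        ≡⟨ +-comm _ (C′ v) ⟩
        C′ v + x m * outdeg G v                        ≡⟨ cong (λ k → C′ v + k * outdeg G v) xv≡xm ⟨
        C′ v + x v * outdeg G v                        ≡⟨ equation (mv v v≢s) ⟨
        C v + inflow G x v                             ≡⟨ +-comm (C v) _ ⟩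
        inflow G x v + C v                             ∎)
      where
      open ≤-Reasoning
      A : Fin n → Bool
      A u = does (x u ℕ.≟ x m)
      xs<xm : x s < x m
      xs<xm = <-≤-trans xs<xw (x≤xm w)
      xv≡xm : x v ≡ x m
      xv≡xm = does⇒ (x v ℕ.≟ x m) v∈A
      v≢s : v ≢ s
      v≢s v≡s = <⇒≢ xs<xm (trans (cong x (sym v≡s)) xv≡xm)
      -- Off A, the values of `x` miss the maximum by at least 1; on A the indicator pays for the
      -- added 1.
      below : ∀ u → x u + 1 ≤ x m + 𝟙 (A u)
      below u with m≤n⇒m<n∨m≡n (x≤xm u)
      ... | inj₁ xu<xm = ≤-trans (≤-reflexive (+-comm (x u) 1)) (≤-trans xu<xm (m≤m+n _ _))
      ... | inj₂ xu≡xm = ≤-reflexive (cong₂ _+_ xu≡xm (sym (cong 𝟙 (dec-true (x u ℕ.≟ x m) xu≡xm))))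

  -- At most `indeg G v`, that is `outdeg G v`, arcs enter `v` from A, so any vertex of A will do.
  large⇒allowed : ∀ {Q C} → (∀ v → Q v → outdeg G v ≤ C v) → Allowed G Q C
  large⇒allowed {C = C} large A (v , v∈A) A⊆Q = v , v∈A , (begin
    inflow G (𝟙 ∘ A) v       ≤⟨ inflow-mono G (𝟙≤1 ∘ A) v ⟩
    inflow G (λ _ → 1) v     ≡⟨ inflow-const-outdeg 1 v ⟩
    1 * outdeg G v           ≡⟨ *-identityˡ _ ⟩
    outdeg G v               ≤⟨ large v (A⊆Q v v∈A) ⟩
    C v                      ∎)
    where open ≤-Reasoning

  -- Take for `d` the configuration with `outdeg G v` chips on each `v` off `s`. Adding `d′` leaves
  -- it allowed, and so does the firing that leads to `c`.
  recurrent⇒allowed : ∀ {s c} → Recurrent G s c → Allowed G (_≢ s) (lookup c)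
  recurrent⇒allowed {s} {c} (_ , _ , reachable)
    with d′ , _ , fires , _ ← reachable (restrict s (outdeg G)) (lookup-restrict-sink s (outdeg G))
    = fires-allowed G fires (large⇒allowed λ v v≢s → begin
      outdeg G v                                            ≡⟨ lookup-restrict s (outdeg G) v≢s ⟨
      lookup (restrict s (outdeg G)) v                      ≤⟨ m≤m+n _ _ ⟩
      lookup (restrict s (outdeg G)) v + lookup d′ v        ≡⟨ lookup∘tabulate _ v ⟨
      lookup (_⊕_ G (restrict s (outdeg G)) d′) v           ∎)
    where open ≤-Reasoning

  -- As `z` vanishes at `s` and not at `w`, the maximum principle yields a vertex that can legally
  -- fire and that `z` still has to fire. One firing is taken off `z`.
  fire-towards-allowed : ∀ {s z e c w} → z s ≡ 0 → 0 < z w →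
    (∀ v → v ≢ s → Moves G z v (lookup e v) (lookup c v)) → Allowed G (_≢ s) (lookup c) →
    ∃₂ λ v z′ → Firable G s e v × ∑ z ≡ suc (∑ z′) × z′ s ≡ 0 ×
      (∀ u → u ≢ s → Moves G z′ u (lookup (fire G s v e) u) (lookup c u))
  fire-towards-allowed {s} {z} {e} {c} {w} zs≡0 0<zw mv allowed
    with v , v≢s , 0<zv , deg≤ev ←
      unsaturated⇒firable {C = lookup e} {lookup c} mv allowed {w} (subst (_< z w) (sym zs≡0) 0<zw)
    = v , z′ , (v≢s , deg≤ev) , ∑z≡ , trans (cong (_∸ δ v s) zs≡0) (0∸n≡0 (δ v s)) ,
      λ u u≢s → Moves-cancel G (fire-Moves G e deg≤ev u u≢s) (Moves-cong G split (mv u u≢s))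
    where
    z′ : Fin n → ℕ
    z′ u = z u ∸ δ v u
    δ≤z : ∀ u → δ v u ≤ z u
    δ≤z u with v ≟ u
    ... | yes refl = ≤-trans (≤-reflexive (δ-refl v)) 0<zv
    ... | no  v≢u  = ≤-trans (≤-reflexive (δ-≢ v≢u)) z≤n
    split : ∀ u → z u ≡ δ v u + z′ u
    split u = sym (m+[n∸m]≡n (δ≤z u))
    ∑z≡ : ∑ z ≡ suc (∑ z′)
    ∑z≡ = trans (∑-cong split) (trans (∑-+ (δ v) z′) (cong (_+ ∑ z′) (∑-δ-one v)))

  Moves-zero⇒≡ : ∀ {z v a b} → (∀ u → z u ≡ 0) → Moves G z v a b → a ≡ b
  Moves-zero⇒≡ {v = v} {a} {b} z≡0 mv = +-cancelʳ-≡ 0 a b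
    (subst (λ k → a + k ≡ b + 0) (inflow-const G 0 v) (equation (Moves-cong G z≡0 mv)))

  -- When the target is allowed, a firing vector vanishing at the sink can be carried out in a legal
  -- order. The induction is on its total number of firings.
  fires-to-allowed : ∀ {s} k z e c → ∑ z ≡ k → z s ≡ 0 → lookup e s ≡ lookup c s →
    (∀ v → v ≢ s → Moves G z v (lookup e v) (lookup c v)) → Allowed G (_≢ s) (lookup c) →
    Fires G s e c
  fires-to-allowed {s} zero z e c ∑z≡0 zs≡0 es≡cs mv allowed = subst (Fires G s e) (lookup-ext e≗c) done
    where
    e≗c : ∀ v → lookup e v ≡ lookup c v
    e≗c v with v ≟ s
    ... | yes refl = es≡cs
    ... | no  v≢s  = Moves-zero⇒≡ (λ u → n≤0⇒n≡0 (subst (z u ≤_) ∑z≡0 (term≤∑ z u))) (mv v v≢s)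
  fires-to-allowed {s} (suc k) z e c ∑z≡ zs≡0 es≡cs mv allowed =
    let w , 0<zw = ∑>0⇒∃>0 z (subst (0 <_) (sym ∑z≡) (s≤s z≤n))
        v , z′ , firable , ∑z≡1+∑z′ , z′s≡0 , mv′ = fire-towards-allowed {e = e} {c} zs≡0 0<zw mv allowed
    in fire-step firable (fires-to-allowed k z′ (fire G s v e) c
      (suc-injective (trans (sym ∑z≡1+∑z′) ∑z≡)) z′s≡0 (trans (lookup-fire-sink G s v e) es≡cs) mv′ allowed)

-- The correspondence between the two sinks

reverse : ∀ {n} → Digraph n → Digraph n
reverse G = record { arcs = λ u v → arcs G v u ; loopless = loopless G }

reverse-eulerian : ∀ {n} {G : Digraph n} → Eulerian G → Eulerian (reverse G)
reverse-eulerian {G = G} (connected , balanced) = (λ u v → flip (connected u v)) , λ v → sym (balanced v)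
  where
  flip : ∀ {u v} → Linked G u v → Linked (reverse G) u v
  flip here              = here
  flip (step (inj₁ a) l) = step (inj₂ a) (flip l)
  flip (step (inj₂ a) l) = step (inj₁ a) (flip l)

module _ {n : ℕ} (G : Digraph n) (eulerian : Eulerian G) where

  private
    balanced = proj₂ eulerian

  -- Unfiring z = y s ∸ y from c, where y is superharmonic, leaves at least d v chips on every v off s.
  allowed⇒recurrent : ∀ {s c} → Config G s c → Stable G s c → Allowed G (_≢ s) (lookup c) → Recurrent G s c
  allowed⇒recurrent {s} {c} cs≡0 stable allowed = cs≡0 , stable , reachable
    where
    reachable : ∀ d → Config G s d → ∃ λ d′ → Config G s d′ × Stabilizes G s (_⊕_ G d d′) c
    -- The total of `d` serves as one margin that covers `d v` for every `v`.
    reachable d ds≡0 with y , y≤ys , super ← superharmonic G eulerian s (∑ (lookup d)) =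
      d′ , lookup-restrict-sink s _ ,
      fires-to-allowed G eulerian (∑ z) z (_⊕_ G d d′) c refl (n∸n≡0 (y s)) sink mv allowed , stable
      where
      z : Fin n → ℕ
      z v = y s ∸ y v
      e : Fin n → ℕ
      -- This is `c` after firing `y`. Up to the constant vector `y s`, that amounts to unfiring
      -- `z`, which has the advantage of vanishing at `s`.
      e v = (lookup c v + inflow G y v) ∸ y v * outdeg G v
      d′ : Vec ℕ n
      d′ = restrict s (λ v → e v ∸ lookup d v)
      y*deg+d≤ : ∀ v → v ≢ s → lookup d v + y v * outdeg G v ≤ lookup c v + inflow G y v
      y*deg+d≤ v v≢s = begin
        lookup d v + y v * outdeg G v         ≤⟨ +-monoˡ-≤ _ (term≤∑ (lookup d) v) ⟩
        ∑ (lookup d) + y v * outdeg G v       ≡⟨ +-comm (∑ (lookup d)) _ ⟩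
        y v * outdeg G v + ∑ (lookup d)       ≡⟨ cong (_+ ∑ (lookup d)) (*-comm (y v) (outdeg G v)) ⟩
        outdeg G v * y v + ∑ (lookup d)       ≤⟨ super v v≢s ⟩
        inflow G y v                          ≤⟨ m≤n+m _ _ ⟩
        lookup c v + inflow G y v             ∎
        where open ≤-Reasoning
      d≤e : ∀ v → v ≢ s → lookup d v ≤ e v
      d≤e v v≢s = m+n≤o⇒m≤o∸n (lookup d v) (y*deg+d≤ v v≢s)
      d⊕d′ : ∀ v → v ≢ s → lookup (_⊕_ G d d′) v ≡ e v
      d⊕d′ v v≢s = begin
        lookup (_⊕_ G d d′) v                 ≡⟨ lookup∘tabulate _ v ⟩
        lookup d v + lookup d′ v              ≡⟨ cong (lookup d v +_) (lookup-restrict s _ v≢s) ⟩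
        lookup d v + (e v ∸ lookup d v)       ≡⟨ m+[n∸m]≡n (d≤e v v≢s) ⟩
        e v                                   ∎
        where open ≡-Reasoning
      sink : lookup (_⊕_ G d d′) s ≡ lookup c s
      sink = begin
        lookup (_⊕_ G d d′) s                 ≡⟨ lookup∘tabulate _ s ⟩
        lookup d s + lookup d′ s              ≡⟨ cong₂ _+_ ds≡0 (lookup-restrict-sink s _) ⟩
        0                                     ≡⟨ cs≡0 ⟨
        lookup c s                            ∎
        where open ≡-Reasoning
      mv : ∀ v → v ≢ s → Moves G z v (lookup (_⊕_ G d d′) v) (lookup c v)
      mv v v≢s = subst (λ k → Moves G z v k (lookup c v)) (sym (d⊕d′ v v≢s))
        (Moves-reverse G eulerian y≤ys
          (moves (sym (m∸n+n≡m (≤-trans (m≤n+m _ (lookup d v)) (y*deg+d≤ v v≢s))))))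

  -- Stabilisation off one vertex without loss of chips

  Stabilised : Fin n → (Fin n → ℕ) → Set
  Stabilised t C = ∃₂ λ x C′ → (∀ v → Moves G x v (C v) (C′ v)) × Allowed G (λ _ → ⊤) C′ ×
    (∀ v → v ≢ t → C′ v < outdeg G v)

  module _ (C : Fin n → ℕ) {v : Fin n} (deg≤C : outdeg G v ≤ C v) where

    -- Unlike `fire`, this has no sink: every vertex keeps what it receives, so the total is
    -- conserved.
    fired : Fin n → ℕ
    fired w = (C w + arcs G v w) ∸ δ v w * outdeg G w

    fired-equation : ∀ w → C w + arcs G v w ≡ fired w + δ v w * outdeg G w
    fired-equation w = sym (m∸n+n≡m (δ*deg≤ w))
      where
      δ*deg≤ : ∀ w → δ v w * outdeg G w ≤ C w + arcs G v w
      δ*deg≤ w with v ≟ w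
      ... | yes refl = ≤-trans (≤-reflexive (trans (cong (_* outdeg G v) (δ-refl v)) (*-identityˡ _)))
                               (≤-trans deg≤C (m≤m+n _ _))
      ... | no  v≢w  = ≤-trans (≤-reflexive (cong (_* outdeg G w) (δ-≢ v≢w))) z≤n

    fired-Moves : ∀ w → Moves G (δ v) w (C w) (fired w)
    fired-Moves w = moves (trans (cong (C w +_) (inflow-δ G v w)) (fired-equation w))

    fired-allowed : ∀ {Q} → Allowed G Q C → Allowed G Q fired
    fired-allowed allowed = allowed-fire G v allowed λ w _ w≢v →
      ≤-reflexive (Moves-δ-off G w≢v (fired-Moves w))

    -- The firing removes weight `outdeg G v * h v` at `v` and adds weight `h w` for each arc from
    -- `v` to `w`.
    fired-weight : ∀ (h : Fin n → ℕ) → outdeg G v * h v < ∑ (λ w → h w * arcs G v w) →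
      ∑ (λ w → h w * C w) < ∑ (λ w → h w * fired w)
    fired-weight h super = +-cancelʳ-< (h v * outdeg G v) _ _ (begin-strict
      ∑ (λ w → h w * C w) + h v * outdeg G v                  ≡⟨ cong (∑ (λ w → h w * C w) +_) (*-comm (h v) (outdeg G v)) ⟩
      ∑ (λ w → h w * C w) + outdeg G v * h v                  <⟨ +-monoʳ-< (∑ (λ w → h w * C w)) super ⟩
      ∑ (λ w → h w * C w) + ∑ (λ w → h w * arcs G v w)        ≡⟨ ∑-+ _ _ ⟨
      ∑ (λ w → h w * C w + h w * arcs G v w)                  ≡⟨ ∑-cong weighted ⟩
      ∑ (λ w → h w * fired w + δ v w * (h w * outdeg G w))    ≡⟨ ∑-+ _ _ ⟩
      ∑ (λ w → h w * fired w) + ∑ (λ w → δ v w * (h w * outdeg G w))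
                                                              ≡⟨ cong (∑ (λ w → h w * fired w) +_) (∑-δ v (λ w → h w * outdeg G w)) ⟩
      ∑ (λ w → h w * fired w) + h v * outdeg G v              ∎)
      where
      open ≤-Reasoning
      distrib : ∀ h f d o → h * (f + d * o) ≡ h * f + d * (h * o)
      distrib = solve-∀
      weighted : ∀ w → h w * C w + h w * arcs G v w ≡ h w * fired w + δ v w * (h w * outdeg G w)
      weighted w = trans (sym (*-distribˡ-+ (h w) _ _))
        (trans (cong (h w *_) (fired-equation w)) (distrib (h w) (fired w) (δ v w) (outdeg G w)))

  -- The weight ∑ h C, for h superharmonic on the reversed digraph, strictly increases with every
  -- firing off t, but is at most h t times the constant number of chips.
  opaque
    stabilise : ∀ t C → Allowed G (λ _ → ⊤) C → Stabilised t C
    stabilise t C allowed with h , h≤ht , super ← superharmonic (reverse G) (reverse-eulerian eulerian) t 1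
      = go (h t * ∑ C) C (m≤m+n _ _) allowed
      where
      weight : (Fin n → ℕ) → ℕ
      weight C = ∑ (λ w → h w * C w)
      weight≤ : ∀ C → weight C ≤ h t * ∑ C
      weight≤ C = ≤-trans (∑-mono (λ w → *-monoˡ-≤ (C w) (h≤ht w))) (≤-reflexive (∑-*ˡ (h t) C))
      super′ : ∀ v → v ≢ t → outdeg G v * h v < ∑ (λ w → h w * arcs G v w)
      -- The margin 1 makes the inequality strict, and balance turns the outdegree in the reversed
      -- digraph into that in `G`.
      super′ v v≢t = ≤-trans (≤-reflexive (trans (cong (λ d → suc (d * h v)) (sym (balanced v))) (+-comm 1 _))) (super v v≢t)
      -- The fuel `k` bounds how much the weight can still grow; `∑ C` is the same throughout.
      go : ∀ k C → h t * ∑ C ≤ k + weight C → Allowed G (λ _ → ⊤) C → Stabilised t C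
      go k C bound allowed with any? (λ v → ¬? (v ≟ t) ×-dec (outdeg G v ≤? C v))
      ... | no  stable = (λ _ → 0) , C , (λ v → Moves-zero G) , allowed ,
                         λ v v≢t → ≰⇒> λ deg≤Cv → stable (v , v≢t , deg≤Cv)
      ... | yes (v , v≢t , deg≤Cv) with ∑-eq ← Moves-∑ G (fired-Moves C deg≤Cv) | k
      ...   | zero = contradiction
          (≤-trans (fired-weight C deg≤Cv h (super′ v v≢t))
            (≤-trans (weight≤ (fired C deg≤Cv)) (≤-trans (≤-reflexive (cong (h t *_) (sym ∑-eq))) bound)))
          (n≮n _)
      ...   | suc k′ with x , C′ , mv , allowed′ , stable ← go k′ (fired C deg≤Cv)
              (≤-trans (≤-reflexive (cong (h t *_) (sym ∑-eq)))
                (≤-trans bound (≤-trans (≤-reflexive (sym (+-suc k′ _)))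
                  (+-monoʳ-≤ k′ (fired-weight C deg≤Cv h (super′ v v≢t))))))
              (fired-allowed C deg≤Cv allowed)
          = (λ u → δ v u + x u) , C′ , (λ w → Moves-trans G (fired-Moves C deg≤Cv w) (mv w)) , allowed′ , stable

  stable⇒sink-maximal : ∀ {s x c c′} → Stable G s c → Allowed G (_≢ s) (lookup c′) →
    (∀ v → v ≢ s → Moves G x v (lookup c v) (lookup c′ v)) → ∀ w → x w ≤ x s
  stable⇒sink-maximal {c = c} {c′} stable allowed mv w = ≮⇒≥ λ xs<xw →
    let v , v≢s , _ , deg≤cv = unsaturated⇒firable G eulerian {C = lookup c} {lookup c′} mv allowed xs<xw
    in stable v (v≢s , deg≤cv)

  -- Since `c` is stable, `x` is maximal at `s`. The reversed vector `x s ∸ x` leads from the stable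
  -- `c′` back to `c`, so it too is maximal at `s`, where it is 0. Hence `x` is constant and moves
  -- nothing.
  recurrent-unique : ∀ {s x c c′} → Recurrent G s c → Recurrent G s c′ →
    (∀ v → v ≢ s → Moves G x v (lookup c v) (lookup c′ v)) → c ≡ c′
  recurrent-unique {s} {x} {c} {c′} rec@(cs≡0 , stable , _) rec′@(c′s≡0 , stable′ , _) mv = lookup-ext c≗c′
    where
    x≤xs : ∀ w → x w ≤ x s
    x≤xs = stable⇒sink-maximal {c = c} {c′} stable (recurrent⇒allowed G eulerian rec′) mv
    mv′ : ∀ v → v ≢ s → Moves G (λ u → x s ∸ x u) v (lookup c′ v) (lookup c v)
    mv′ v v≢s = Moves-reverse G eulerian x≤xs (mv v v≢s)
    deficit≡0 : ∀ w → x s ∸ x w ≡ 0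
    deficit≡0 w = n≤0⇒n≡0 (≤-trans
      (stable⇒sink-maximal {c = c′} {c} stable′ (recurrent⇒allowed G eulerian rec) mv′ w)
      (≤-reflexive (n∸n≡0 (x s))))
    c≗c′ : ∀ v → lookup c v ≡ lookup c′ v
    c≗c′ v with v ≟ s
    ... | yes refl = trans cs≡0 (sym c′s≡0)
    ... | no  v≢s  = sym (Moves-zero⇒≡ G eulerian deficit≡0 (mv′ v v≢s))

  -- Configurations with k chips on all vertices, and the matching

  fill : Fin n → ℕ → Vec ℕ n → Fin n → ℕ
  fill s k c v = lookup c v + δ s v * (k ∸ sum c)

  fill-off : ∀ {s v} k c → v ≢ s → fill s k c v ≡ lookup c v
  fill-off {s} {v} k c v≢s = trans (cong (λ d → lookup c v + d * (k ∸ sum c)) (δ-≢ (v≢s ∘ sym))) (+-identityʳ _)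

  fill-sink : ∀ {s} k c → Config G s c → fill s k c s ≡ k ∸ sum c
  fill-sink {s} k c cs≡0 = trans (cong₂ (λ a d → a + d * (k ∸ sum c)) cs≡0 (δ-refl s)) (*-identityˡ _)

  ∑-fill : ∀ {s k c} → sum c ≤ k → ∑ (fill s k c) ≡ k
  ∑-fill {s} {k} {c} c≤k = begin
    ∑ (fill s k c)                                        ≡⟨ ∑-+ _ _ ⟩
    ∑ (lookup c) + ∑ (λ v → δ s v * (k ∸ sum c))          ≡⟨ cong₂ _+_ (sym (sum-lookup c)) (∑-δ s (λ _ → k ∸ sum c)) ⟩
    sum c + (k ∸ sum c)                                   ≡⟨ m+[n∸m]≡n c≤k ⟩
    k                                                     ∎
    where open ≡-Reasoning

  -- The chips that `restrict` forgets on `t` are recovered from the total `k`.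
  fill-restrict : ∀ {t k} C → ∑ C ≡ k → ∀ v → fill t k (restrict t C) v ≡ C v
  fill-restrict {t} {k} C ∑C≡k v with v ≟ t
  ... | no  v≢t  = trans (fill-off k (restrict t C) v≢t) (lookup-restrict t C v≢t)
  ... | yes refl = trans (fill-sink k (restrict t C) (lookup-restrict-sink t C))
                         (trans (cong (_∸ sum (restrict t C)) (trans (sym ∑C≡k) (∑-restrict t C))) (m+n∸m≡n (sum (restrict t C)) (C t)))

  -- A set containing `s` is served by `s` itself, which holds at least `outdeg G s` chips; any
  -- other set is served because `c` is recurrent.
  fill-allowed : ∀ {s k c} → Recurrent G s c → sumGs G s c ≤ k → Allowed G (λ _ → ⊤) (fill s k c)
  fill-allowed {s} {k} {c} rec@(cs≡0 , _) sum≤k A (a , a∈A) _ with A s in s∈?A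
  ... | true  = s , s∈?A , (begin
    inflow G (𝟙 ∘ A) s      ≤⟨ inflow-mono G (𝟙≤1 ∘ A) s ⟩
    inflow G (λ _ → 1) s    ≡⟨ inflow-const-outdeg G eulerian 1 s ⟩
    1 * outdeg G s          ≡⟨ *-identityˡ _ ⟩
    outdeg G s              ≤⟨ m+n≤o⇒m≤o∸n (outdeg G s) sum≤k ⟩
    k ∸ sum c               ≡⟨ fill-sink k c cs≡0 ⟨
    fill s k c s            ∎)
    where open ≤-Reasoning
  ... | false
    with v , v∈A , low ← recurrent⇒allowed G eulerian rec A (a , a∈A)
      (λ v v∈A v≡s → contradiction (trans (sym v∈A) (trans (cong A v≡s) s∈?A)) λ ())
    = v , v∈A , ≤-trans low (m≤m+n _ _)

  stabilised-recurrent : ∀ {t C} → Allowed G (λ _ → ⊤) C → (∀ v → v ≢ t → C v < outdeg G v) →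
    Recurrent G t (restrict t C) × sumGs G t (restrict t C) ≤ ∑ C
  stabilised-recurrent {t} {C} allowed stable =
    allowed⇒recurrent (lookup-restrict-sink t C) stable′ allowed′ , (begin
      outdeg G t + sum (restrict t C)   ≤⟨ +-monoˡ-≤ _ deg≤Ct ⟩
      C t + sum (restrict t C)          ≡⟨ +-comm (C t) _ ⟩
      sum (restrict t C) + C t          ≡⟨ ∑-restrict t C ⟨
      ∑ C                               ∎)
    where
    open ≤-Reasoning
    stable′ : Stable G t (restrict t C)
    stable′ v (v≢t , deg≤) = <⇒≱ (stable v v≢t) (subst (outdeg G v ≤_) (lookup-restrict t C v≢t) deg≤)
    allowed′ : Allowed G (_≢ t) (lookup (restrict t C))
    allowed′ A nonempty A⊆ with v , v∈A , low ← allowed A nonempty (λ _ _ → tt)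
      = v , v∈A , ≤-trans low (≤-reflexive (sym (lookup-restrict t C (A⊆ v v∈A))))
    deg≤Ct : outdeg G t ≤ C t
    -- For the set of all vertices, the arcs into `v` number `outdeg G v`, and stability excludes
    -- every `v` other than `t`.
    deg≤Ct with v , _ , low ← allowed (λ _ → true) (t , refl) (λ _ _ → tt)
      with v ≟ t | subst (_≤ C v) (trans (inflow-const-outdeg G eulerian 1 v) (*-identityˡ _)) low
    ... | yes refl | deg≤ = deg≤
    ... | no  v≢t  | deg≤ = contradiction deg≤ (<⇒≱ (stable v v≢t))

  -- Recurrence of `c` is built in because the injectivity argument of `matching-length-≤` receives
  -- only the relation.
  _∼[_,_,_]_ : Vec ℕ n → Fin n → Fin n → ℕ → Vec ℕ n → Set
  c ∼[ s , t , k ] c′ = Recurrent G s c × ∃ λ x → ∀ v → Moves G x v (fill s k c v) (fill t k c′ v)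

  opaque
    ∼-exists : ∀ {s k c} t → Recurrent G s c → sumGs G s c ≤ k →
      ∃ λ c′ → Recurrent G t c′ × sumGs G t c′ ≤ k × c ∼[ s , t , k ] c′
    ∼-exists {s} {k} {c} t rec sum≤k
      with x , C , mv , allowed , stable ← stabilise t (fill s k c) (fill-allowed rec sum≤k)
      with rec′ , sum′≤ ← stabilised-recurrent allowed stable
      = restrict t C , rec′ , subst (_ ≤_) ∑C≡k sum′≤ , rec , x , λ v →
        subst (Moves G x v (fill s k c v)) (sym (fill-restrict C ∑C≡k v)) (mv v)
      where
      ∑C≡k : ∑ C ≡ k
      ∑C≡k = trans (sym (Moves-∑ G mv)) (∑-fill {s} {c = c} (m+n≤o⇒n≤o (outdeg G s) sum≤k))

  -- Going from `c₁` to `c′` and back along the reversal of `x₂` gives a firing vector from `c₁` to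
  -- `c₂`. Off `s` the filled configurations are the original ones, so `recurrent-unique` applies.
  ∼-injective : ∀ {s t k c₁ c₂ c′} → c₁ ∼[ s , t , k ] c′ → c₂ ∼[ s , t , k ] c′ → c₁ ≡ c₂
  ∼-injective {s} {t} {k} {c₁} {c₂} (rec₁ , x₁ , mv₁) (rec₂ , x₂ , mv₂) =
    recurrent-unique rec₁ rec₂ λ v v≢s →
      subst₂ (Moves G _ v) (fill-off k c₁ v≢s) (fill-off k c₂ v≢s)
        (Moves-trans G (mv₁ v) (Moves-reverse G eulerian (proj₂ (maximal s x₂)) (mv₂ v)))

  #below-≤ : ∀ {s t Ls Lt} → EnumeratesRecurrent G s Ls → EnumeratesRecurrent G t Lt → ∀ k →
    #below k (map (sumGs G s) Ls) ≤ #below k (map (sumGs G t) Lt)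
  #below-≤ {s} {t} {Ls} {Lt} (unique , enum) (_ , enum′) k =
    subst₂ _≤_ (sym (#below-map (sumGs G s) k Ls)) (sym (#below-map (sumGs G t) k Lt))
      -- A sum below `k` is a sum at most `pred k`, so `pred k` chips are distributed. For `k` equal
      -- to 0 there is nothing to match.
      (matching-length-≤ (λ c c′ → c ∼[ s , t , ℕ.pred k ] c′)
        (λ {_} {_} {c′} → ∼-injective {t = t} {c′ = c′}) _ _
        (filter⁺ (λ c → sumGs G s c <? k) unique) match)
    where
    match : ∀ {c} → c ∈ filter (λ c → sumGs G s c <? k) Ls →
      ∃ λ c′ → c′ ∈ filter (λ c → sumGs G t c <? k) Lt × c ∼[ s , t , ℕ.pred k ] c′
    match {c} c∈ with c∈Ls , sum<k ← ∈-filter⁻ (λ c → sumGs G s c <? k) {xs = Ls} c∈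
      with c′ , rec′ , sum′≤ , c∼c′ ← ∼-exists t (proj₁ (enum c) c∈Ls) (<⇒≤pred sum<k)
      = c′ , ∈-filter⁺ (λ c → sumGs G t c <? k) (proj₂ (enum′ c′) rec′) 
          (m≤pred[n]⇒suc[m]≤n {{ℕ.>-nonZero (≤-<-trans z≤n sum<k)}} sum′≤) , c∼c′

theorem1 : (n : ℕ) (G : Digraph n) → Eulerian G →
    (s t : Fin n) (Ls Lt : List (Vec ℕ n)) →
    EnumeratesRecurrent G s Ls → EnumeratesRecurrent G t Lt →
    map (sumGs G s) Ls ↭ map (sumGs G t) Lt
theorem1 n G eulerian s t Ls Lt enum enum′ = #below-≡⇒↭ _ _ λ k →
  ≤-antisym (#below-≤ G eulerian enum enum′ k) (#below-≤ G eulerian enum′ enum k)
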